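{- Let $h,m,n,a$ be positive integers. Then \[ \frac{\gcd(2,n)}{n(n+1)(n+2)}\sum_{k=1}^{n}k^{a}(k+1)^{a}(2k+1)S_{k}^{(h)}(x)^{m}\in\mathbb{Z}[x] \] and \[ \frac{\gcd(2,m-1,n)}{n(n+1)(n+2)}\sum_{k=1}^{n}(-1)^{k}k^{a}(k+1)^{a}(2k+1)S_{k}^{(h)}(x)^{m}\in\mathbb{Z}[x]. \]
   Context: For $h\in\mathbb{Z}^+$ and $n\in\mathbb{N}$, the generalized Schröder polynomial is $S_{n}^{(h)}(x)=\sum_{k=0}^{n}\binom{n+k}{2k}^{h}C_{k}^{h}x^{k}$, where $C_k=\frac{1}{k+1}\binom{2k}{k}$ is the $k$-th Catalan number. $\gcd(\cdot)$ denotes greatest common divisor. -}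

module Defs where

open import Data.Nat as ℕ using (ℕ; zero; suc)
open import Data.Nat.Combinatorics using (_C_)
open import Data.Nat.GCD using (gcd)
open import Data.Integer as ℤ using (ℤ; +_)
open import Data.Integer.Divisibility using (_∣_)
open import Data.List using (List; []; _∷_; map; upTo)

-- Catalan number C_k = binom(2k,k)/(k+1) (exact division in ℕ)
catalan : ℕ → ℕ
catalan k = ((2 ℕ.* k) C k) ℕ./ suc k

-- Polynomials in ℤ[x], represented by coefficient lists (lowest degree first).
Poly : Set
Poly = List ℤ

coeff : Poly → ℕ → ℤ
coeff []       _       = + 0
coeff (c ∷ p)  zero    = c
coeff (c ∷ p)  (suc i) = coeff p i

infixl 6 _⊕_
infixl 7 _⊛_ _·_

_⊕_ : Poly → Poly → Poly
[]      ⊕ q       = q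
p       ⊕ []      = p
(a ∷ p) ⊕ (b ∷ q) = (a ℤ.+ b) ∷ (p ⊕ q)

_·_ : ℤ → Poly → Poly
c · p = map (c ℤ.*_) p

_⊛_ : Poly → Poly → Poly
[]      ⊛ q = []
(a ∷ p) ⊛ q = (a · q) ⊕ ((+ 0) ∷ (p ⊛ q))

one : Poly
one = + 1 ∷ []

_^ₚ_ : Poly → ℕ → Poly
p ^ₚ zero  = one
p ^ₚ suc m = p ⊛ (p ^ₚ m)

schroder : ℕ → ℕ → Poly
schroder h n = map (λ k → + (((n ℕ.+ k) C (2 ℕ.* k)) ℕ.^ h ℕ.* catalan k ℕ.^ h))
                   (upTo (suc n))

sumPoly : ℕ → (ℕ → Poly) → Poly
sumPoly zero    f = []
sumPoly (suc n) f = sumPoly n f ⊕ f (suc n)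

sign : ℕ → ℤ
sign zero    = + 1
sign (suc k) = ℤ.- sign k

weight : ℕ → ℕ → ℤ
weight a k = + (k ℕ.^ a ℕ.* suc k ℕ.^ a ℕ.* suc (2 ℕ.* k))

sum₁ : ℕ → ℕ → ℕ → ℕ → Poly
sum₁ h m a n = sumPoly n (λ k → weight a k · (schroder h k ^ₚ m))

sum₂ : ℕ → ℕ → ℕ → ℕ → Poly
sum₂ h m a n = sumPoly n (λ k → (sign k ℤ.* weight a k) · (schroder h k ^ₚ m))

-- "(c / d) · P ∈ ℤ[x]" : every coefficient of c·P is divisible by d
IntegralQuot : ℕ → ℕ → Poly → Set
IntegralQuot c d p = ∀ i → (+ d) ∣ (+ c ℤ.* coeff p i)

{-# OPTIONS --safe #-}
module Submission where

-- Put b_j(k) = binom(k+j, 2j) C_j and t_j(n) = (n+j+1) b_j(n). Two telescoping sums drive the argument: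
--   (j+2) Σ_{k≤n} k(k+1)(2k+1) b_j(k) = n(n+1)(n+2) t_j(n),
--   Σ_{k≤n} (-1)^k k(k+1)(2k+1) b_j(k) = (-1)^n t_j(n) (n(n+2) - j).
-- Their divisibility by n(n+1)(n+2) holds up to a factor 2, and exactly for odd n. The ℤ-span of the b_j is
-- closed under multiplication, by the linearization
--   (j+1) b_i b_j = Σ_s binom(i,s) binom(s+j+1,i+1) binom(i+j,i) b_{s+j},
-- whose coefficients are divisible by j+1, and under multiplication by k(k+1); so it contains all coefficients
-- of the summands. In the alternating sum the factor 2 can also be dropped for b_0 and, for odd l, for
-- b_l + b_{l+1}. Modulo 2 the square b_j² is a combination of these, hence so is every square of an element of
-- the span, and if m is even then S_k^m is a square, whose coefficients are squares modulo 2.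

open import Defs
open import Data.Nat as ℕ using (ℕ; zero; suc; _∸_; _≥_; z≤n; s≤s)
import Data.Nat.Properties as ℕ
import Data.Nat.Divisibility as ℕ
import Data.Nat.DivMod as ℕ
open import Data.Nat.Combinatorics using (_C_; nC1≡n; nCk+nC[k+1]≡[n+1]C[k+1]; k>n⇒nCk≡0)
open import Data.Nat.GCD using (gcd; gcd-greatest)
open import Data.Integer using (ℤ; +_; -_; _+_; _-_; _*_; _^_; ∣_∣)
open import Data.Integer.Properties using
  ( +-0-abelianGroup; +-assoc; +-comm; +-identityˡ; +-identityʳ; *-assoc; *-comm; *-identityˡ; *-identityʳ
  ; *-zeroʳ; *-cancelˡ-≡; pos-* )
open import Data.Integer.Divisibility.Signed
open import Data.Integer.Tactic.RingSolver using (solve)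
open import Data.List using ([]; _∷_; map; applyUpTo)
open import Data.Product using (∃; _×_; _,_; proj₁; proj₂)
open import Data.Sum using (_⊎_; inj₁; inj₂)
open import Relation.Binary.PropositionalEquality
open import Algebra.Properties.AbelianGroup +-0-abelianGroup using (∙-cancelʳ)
open import Algebra.Properties.CommutativeSemigroup ℕ.+-commutativeSemigroup using (interchange)

-- Linear combinations of integer equations

-- The coefficients are those of a linear combination: a - b = c (l - r) + c′ (l′ - r′) + ….
lincomb₁ : ∀ c {l r a b} → l ≡ r → a + c * r ≡ b + c * l → a ≡ b
lincomb₁ c {l} refl eq = ∙-cancelʳ (c * l) _ _ eq

lincomb₂ : ∀ c c′ {l r l′ r′ a b} → l ≡ r → l′ ≡ r′ →
           a + c * r + c′ * r′ ≡ b + c * l + c′ * l′ → a ≡ b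
lincomb₂ c c′ h h′ eq = lincomb₁ c h (lincomb₁ c′ h′ eq)

lincomb₃ : ∀ c c′ c″ {l r l′ r′ l″ r″ a b} → l ≡ r → l′ ≡ r′ → l″ ≡ r″ →
           a + c * r + c′ * r′ + c″ * r″ ≡ b + c * l + c′ * l′ + c″ * l″ → a ≡ b
lincomb₃ c c′ c″ h h′ h″ eq = lincomb₂ c c′ h h′ (lincomb₁ c″ h″ eq)

cancel-suc : ∀ j {x y} → (+ 1 + + j) * x ≡ (+ 1 + + j) * y → x ≡ y
cancel-suc j {x} {y} = *-cancelˡ-≡ (+ suc j) x y

-- Binomial coefficients and Catalan numbers

-- Opaque, since otherwise unification unfolds the integer division behind _C_.
opaque
  binom : ℕ → ℕ → ℤ
  binom n k = + (n C k)

  binom-def : ∀ n k → binom n k ≡ + (n C k)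
  binom-def n k = refl

  pascal : ∀ n k → binom (suc n) (suc k) ≡ binom n k + binom n (suc k)
  pascal n k = cong +_ (sym (nCk+nC[k+1]≡[n+1]C[k+1] n k))

  binom-zero : ∀ n → binom n 0 ≡ + 1
  binom-zero n = refl

  binom-one : ∀ n → binom n 1 ≡ + n
  binom-one n = cong +_ (nC1≡n n)

  binom-vanish : ∀ {n k} → n ℕ.< k → binom n k ≡ + 0
  binom-vanish n<k = cong +_ (k>n⇒nCk≡0 n<k)

-- Together with Pascal's rule this yields `lower-step` and `upper-step`. All ratios of neighbouring
-- binomials are kept cross-multiplied, so that later identities become linear combinations of them.
absorb : ∀ n k → (+ 1 + + k) * binom (suc n) (suc k) ≡ (+ 1 + + n) * binom n k
absorb zero zero rewrite binom-one 1 | binom-zero 0 = refl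
absorb zero (suc k)
  rewrite binom-vanish {1} {suc (suc k)} (s≤s (s≤s z≤n)) | binom-vanish {0} {suc k} (s≤s z≤n)
  = *-zeroʳ (+ 1 + + suc k)
absorb (suc n) zero rewrite binom-one (suc (suc n)) | binom-zero (suc n) = *-comm (+ 1) (+ 2 + + n)
absorb (suc n) (suc k) =
  reorder (+ n) (+ k) _ _ _ _ _ (pascal (suc n) (suc k)) (absorb n k) (absorb n (suc k)) (pascal n k)
  where
  reorder : ∀ n k p q r s t → p ≡ q + r → (+ 1 + k) * q ≡ (+ 1 + n) * s →
            (+ 1 + (+ 1 + k)) * r ≡ (+ 1 + n) * t → q ≡ s + t →
            (+ 1 + (+ 1 + k)) * p ≡ (+ 1 + (+ 1 + n)) * q
  reorder n k p q r s t refl h₁ h₂ h₃ =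
    lincomb₃ (+ 1) (+ 1) (- (+ 1 + n)) h₁ h₂ h₃ (solve (n ∷ k ∷ q ∷ r ∷ s ∷ t ∷ []))

lower-step : ∀ n k → (+ 1 + + k) * binom n (suc k) ≡ (+ n - + k) * binom n k
lower-step n k = combine (+ n) (+ k) _ _ _ (absorb n k) (pascal n k)
  where
  combine : ∀ n k p q r → (+ 1 + k) * p ≡ (+ 1 + n) * q → p ≡ q + r →
            (+ 1 + k) * r ≡ (n - k) * q
  combine n k p q r h refl = lincomb₁ (+ 1) h (solve (n ∷ k ∷ q ∷ r ∷ []))

upper-step : ∀ n k → (+ 1 + + n - + k) * binom (suc n) k ≡ (+ 1 + + n) * binom n k
upper-step n zero = cong₂ _*_ (+-identityʳ (+ suc n)) (trans (binom-zero (suc n)) (sym (binom-zero n)))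
upper-step n (suc k) = combine (+ n) (+ k) _ _ _ (lower-step n k) (pascal n k)
  where
  combine : ∀ n k p q r → (+ 1 + k) * r ≡ (n - k) * q → p ≡ q + r →
            (+ 1 + n - (+ 1 + k)) * p ≡ (+ 1 + n) * r
  combine n k p q r h refl = lincomb₁ (- (+ 1)) h (solve (n ∷ k ∷ q ∷ r ∷ []))

-- The quotient is the difference form binom(2j, j) - binom(2j, j+1) of the Catalan number. It makes
-- the natural-number division in `catalan` exact.
suc∣central : ∀ j → + suc j ∣ binom (2 ℕ.* j) j
suc∣central j = divides (binom (2 ℕ.* j) j - binom (2 ℕ.* j) (suc j))
                        (factor (+ j) _ _ (lower-step (2 ℕ.* j) j))
  where
  factor : ∀ j x y → (+ 1 + j) * y ≡ (j + (j + + 0) - j) * x → x ≡ (x - y) * (+ 1 + j)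
  factor j x y h = lincomb₁ (+ 1) h (solve (j ∷ x ∷ y ∷ []))

opaque
  unfolding binom

  cat : ℕ → ℤ
  cat j = + catalan j

  cat-def : ∀ j → cat j ≡ + catalan j
  cat-def j = refl

  cat-zero : cat 0 ≡ + 1
  cat-zero = refl

  suc*cat : ∀ j → (+ 1 + + j) * cat j ≡ binom (2 ℕ.* j) j
  suc*cat j = begin
    + suc j * + catalan j           ≡⟨ pos-* (suc j) (catalan j) ⟨
    + (suc j ℕ.* catalan j)         ≡⟨ cong +_ (ℕ.*-comm (suc j) (catalan j)) ⟩
    + (catalan j ℕ.* suc j)         ≡⟨ cong +_ (ℕ.m/n*n≡m (∣⇒∣ᵤ (suc∣central j))) ⟩
    binom (2 ℕ.* j) j               ∎
    where open ≡-Reasoning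

double-suc : ∀ j → 2 ℕ.* suc j ≡ suc (suc (2 ℕ.* j))
double-suc j = cong suc (ℕ.+-suc j (j ℕ.+ 0))

cat-suc : ∀ j → (+ 2 + + j) * cat (suc j) ≡ + 2 * (+ 1 + + 2 * + j) * cat j
cat-suc j = cancel-suc j (cancel-suc j (combine (+ j) (suc*cat j) central
    (absorb (suc (2 ℕ.* j)) j) (upper-step (2 ℕ.* j) j)))
  where
  central : (+ 2 + + j) * cat (suc j) ≡ binom (suc (suc (2 ℕ.* j))) (suc j)
  central = trans (suc*cat (suc j)) (cong (λ m → binom m (suc j)) (double-suc j))
  combine : ∀ j {c d x y z} → (+ 1 + j) * c ≡ x → (+ 2 + j) * d ≡ y →
            (+ 1 + j) * y ≡ (+ 1 + (+ 1 + (j + (j + + 0)))) * z →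
            (+ 1 + (j + (j + + 0)) - j) * z ≡ (+ 1 + (j + (j + + 0))) * x →
            (+ 1 + j) * ((+ 1 + j) * ((+ 2 + j) * d)) ≡
            (+ 1 + j) * ((+ 1 + j) * (+ 2 * (+ 1 + + 2 * j) * c))
  combine j {c} {d} {z = z} refl refl h₁ h₂ =
    lincomb₂ (+ 1 + j) (+ 2 * (+ 1 + j)) h₁ h₂ (solve (j ∷ c ∷ d ∷ z ∷ []))

-- The polynomials b_j

-- The coefficient of x^j in S_k^(1)(x); as a function of k it is a polynomial in k(k+1).
basis : ℕ → ℕ → ℤ
basis j k = binom (k ℕ.+ j) (2 ℕ.* j) * cat j

-- Iterated, this says j! (j+1)! b_j(k) = Π_{i<j} (k(k+1) - i(i+1)). The expansions of k(k+1) b_j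
-- and of b_i b_j both rest on it.
basis-suc : ∀ j k → (+ 1 + + j) * (+ 2 + + j) * basis (suc j) k ≡
                    (+ k * (+ 1 + + k) - + j * (+ 1 + + j)) * basis j k
basis-suc j k = trans
  (cong (λ b → (+ 1 + + j) * (+ 2 + + j) * (b * cat (suc j)))
        (cong₂ binom (ℕ.+-suc k j) (double-suc j)))
  (combine (+ j) (+ k) (cat-suc j) (absorb (k ℕ.+ j) (suc (2 ℕ.* j))) (lower-step (k ℕ.+ j) (2 ℕ.* j)))
  where
  combine : ∀ j k {c d x y z} → (+ 2 + j) * d ≡ + 2 * (+ 1 + + 2 * j) * c →
            (+ 1 + (+ 1 + (j + (j + + 0)))) * x ≡ (+ 1 + (k + j)) * y →
            (+ 1 + (j + (j + + 0))) * y ≡ (k + j - (j + (j + + 0))) * z →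
            (+ 1 + j) * (+ 2 + j) * (x * d) ≡ (k * (+ 1 + k) - j * (+ 1 + j)) * (z * c)
  combine j k {c} {d} {x} {y} {z} h₁ h₂ h₃ =
    lincomb₃ ((+ 1 + j) * x) ((+ 1 + + 2 * j) * c) ((+ 1 + (k + j)) * c) h₁ h₂ h₃
      (solve (j ∷ k ∷ c ∷ d ∷ x ∷ y ∷ z ∷ []))

basis-shift : ∀ j k → (+ 1 + + k + + j) * basis j k ≡ (+ 1 + + k - + j) * basis j (suc k)
basis-shift j k = combine (+ j) (+ k) (cat j) (upper-step (k ℕ.+ j) (2 ℕ.* j))
  where
  combine : ∀ j k c {x y} → (+ 1 + (k + j) - (j + (j + + 0))) * x ≡ (+ 1 + (k + j)) * y →
            (+ 1 + k + j) * (y * c) ≡ (+ 1 + k - j) * (x * c)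
  combine j k c {x} {y} h = lincomb₁ (- c) h (solve (j ∷ k ∷ c ∷ x ∷ y ∷ []))

basis-zero : ∀ k → basis 0 k ≡ + 1
basis-zero k = cong₂ _*_ (binom-zero (k ℕ.+ 0)) cat-zero

-- Trinomial revision, binom(n+j, 2j) binom(2j, j) = binom(n, j) binom(n+j, j), by induction on j:
-- both sides have the same ratio of consecutive terms.
suc*basis : ∀ j n → (+ 1 + + j) * basis j n ≡ binom n j * binom (n ℕ.+ j) j
suc*basis zero n = trans (cong (+ 1 *_) (basis-zero n))
  (sym (cong₂ _*_ (binom-zero n) (binom-zero (n ℕ.+ 0))))
suc*basis (suc j) n = trans
  (cancel-suc j (cancel-suc j (combine (+ j) (+ n) (basis-suc j n)
    (suc*basis j n) (lower-step n j) (absorb (n ℕ.+ j) j))))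
  (cong (λ m → binom n (suc j) * binom m (suc j)) (sym (ℕ.+-suc n j)))
  where
  combine : ∀ j n {x y p q r s} → (+ 1 + j) * (+ 2 + j) * y ≡ (n * (+ 1 + n) - j * (+ 1 + j)) * x →
            (+ 1 + j) * x ≡ p * q → (+ 1 + j) * r ≡ (n - j) * p → (+ 1 + j) * s ≡ (+ 1 + (n + j)) * q →
            (+ 1 + j) * ((+ 1 + j) * ((+ 1 + (+ 1 + j)) * y)) ≡ (+ 1 + j) * ((+ 1 + j) * (r * s))
  combine j n {x} {y} {p} {q} {r} {s} h₁ h₂ h₃ h₄ =
    lincomb₂ (+ 1 + j) (n * (+ 1 + n) - j * (+ 1 + j)) h₁ h₂
      (lincomb₂ (- ((+ 1 + j) * s)) (- ((n - j) * p)) h₃ h₄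
        (solve (j ∷ n ∷ x ∷ y ∷ p ∷ q ∷ r ∷ s ∷ [])))

-- Telescoping sums and their divisibility

parity : ∀ n → (∃ λ r → n ≡ r ℕ.+ r) ⊎ (∃ λ r → n ≡ suc (r ℕ.+ r))
parity zero = inj₁ (0 , refl)
parity (suc n) with parity n
... | inj₁ (r , refl) = inj₂ (r , refl)
... | inj₂ (r , refl) = inj₁ (suc r , cong suc (sym (ℕ.+-suc r r)))

-- Up to the sign (-1)^n, this is the sum of (-1)^k (2k+1) * basis j k over 0 ≤ k ≤ n.
top : ℕ → ℕ → ℤ
top j n = (+ 1 + + n + + j) * basis j n

top-suc : ∀ j n → (+ 1 + + j) * (+ 2 + + j) * top (suc j) n ≡
                  (+ n - + j) * (+ 2 + + n + + j) * top j n
top-suc j n = combine (+ j) (+ n) {basis j n} {basis (suc j) n} (basis-suc j n)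
  where
  combine : ∀ j n {x y} → (+ 1 + j) * (+ 2 + j) * y ≡ (n * (+ 1 + n) - j * (+ 1 + j)) * x →
            (+ 1 + j) * (+ 2 + j) * ((+ 1 + n + (+ 1 + j)) * y) ≡
            (n - j) * (+ 2 + n + j) * ((+ 1 + n + j) * x)
  combine j n {x} {y} h = lincomb₁ (+ 2 + n + j) h (solve (j ∷ n ∷ x ∷ y ∷ []))

-- Absorbing n+j+1 into the binomial gives 2 t_j = 2(2j+1) binom(n+j+1, 2j+1) C_j, and 2(2j+1) C_j =
-- (j+2) C_{j+1}.
2+j∣2*top : ∀ j n → + 2 + + j ∣ + 2 * top j n
2+j∣2*top j n = divides (binom (suc (n ℕ.+ j)) (suc (2 ℕ.* j)) * cat (suc j))
  (combine (+ j) (+ n) {binom (n ℕ.+ j) (2 ℕ.* j)} {binom (suc (n ℕ.+ j)) (suc (2 ℕ.* j))}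
    {cat j} {cat (suc j)} (absorb (n ℕ.+ j) (2 ℕ.* j)) (cat-suc j))
  where
  combine : ∀ j n {x y c d} → (+ 1 + (j + (j + + 0))) * y ≡ (+ 1 + (n + j)) * x →
            (+ 2 + j) * d ≡ + 2 * (+ 1 + + 2 * j) * c →
            + 2 * ((+ 1 + n + j) * (x * c)) ≡ y * d * (+ 2 + j)
  combine j n {x} {y} {c} {d} h₁ h₂ = lincomb₂ (- (+ 2 * c)) (- y) h₁ h₂
    (solve (j ∷ n ∷ x ∷ y ∷ c ∷ d ∷ []))

-- As n(n+1) - j(j+1) = (n-j)(n+j+1), `basis-suc` shows that j+2 divides (n-j) t_j. It also divides
-- 2 t_j, hence (n+1) t_j because n+1 = 2(r+1), and so it divides t_j = ((n-j) + (j+2) - (n+1)) t_j.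
2+j∣top : ∀ j r → + 2 + + j ∣ top j (suc (r ℕ.+ r))
2+j∣top j r with 2+j∣2*top j (suc (r ℕ.+ r))
... | divides q eq = divides
  ((+ 1 + + j) * basis (suc j) n + top j n - (+ 1 + + r) * q)
  (combine (+ j) (+ r) q {basis j n} {basis (suc j) n} (basis-suc j n) eq)
  where
  n = suc (r ℕ.+ r)
  combine : ∀ j r q {x y} → let n = + 1 + (r + r); t = (+ 1 + n + j) * x in
            (+ 1 + j) * (+ 2 + j) * y ≡ (n * (+ 1 + n) - j * (+ 1 + j)) * x →
            + 2 * t ≡ q * (+ 2 + j) →
            t ≡ ((+ 1 + j) * y + t - (+ 1 + r) * q) * (+ 2 + j)
  combine j r q {x} {y} h₁ h₂ = lincomb₂ (- (+ 1)) (- (+ 1 + r)) h₁ h₂ (solve (j ∷ r ∷ q ∷ x ∷ y ∷ []))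

suc*top : ∀ j n → (+ 1 + + j) * top j n ≡ (+ 1 + + n) * (binom n j * binom (suc (n ℕ.+ j)) j)
suc*top j n = combine (+ j) (+ n) {basis j n} {binom n j} {binom (n ℕ.+ j) j} {binom (suc (n ℕ.+ j)) j}
  (suc*basis j n) (upper-step (n ℕ.+ j) j)
  where
  combine : ∀ j n {b p q s} → (+ 1 + j) * b ≡ p * q → (+ 1 + (n + j) - j) * s ≡ (+ 1 + (n + j)) * q →
            (+ 1 + j) * ((+ 1 + n + j) * b) ≡ (+ 1 + n) * (p * s)
  combine j n {b} {p} {q} {s} h₁ h₂ = lincomb₂ (+ 1 + n + j) (- p) h₁ h₂
    (solve (j ∷ n ∷ b ∷ p ∷ q ∷ s ∷ []))

-- Of the two product forms of t_j, this one has the factor binom(n, j), from which j extracts n;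
-- `top≡₂` has binom(n+j+1, j), from which j extracts n+2.
top≡₁ : ∀ j n → top j n ≡ binom n j * binom (suc (n ℕ.+ j)) (suc j)
top≡₁ j n = cancel-suc j (combine (+ j) (+ n) {basis j n} {binom n j} {binom (n ℕ.+ j) j}
  {binom (suc (n ℕ.+ j)) (suc j)} (suc*basis j n) (absorb (n ℕ.+ j) j))
  where
  combine : ∀ j n {b p q s} → (+ 1 + j) * b ≡ p * q → (+ 1 + j) * s ≡ (+ 1 + (n + j)) * q →
            (+ 1 + j) * ((+ 1 + n + j) * b) ≡ (+ 1 + j) * (p * s)
  combine j n {b} {p} {q} {s} h₁ h₂ = lincomb₂ (+ 1 + n + j) (- p) h₁ h₂
    (solve (j ∷ n ∷ b ∷ p ∷ q ∷ s ∷ []))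

top≡₂ : ∀ j n → top j n ≡ binom (suc n) (suc j) * binom (suc (n ℕ.+ j)) j
top≡₂ j n = cancel-suc j (combine (+ j) (+ n) {top j n} {binom n j} {binom (suc (n ℕ.+ j)) j}
  {binom (suc n) (suc j)} (suc*top j n) (absorb n j))
  where
  combine : ∀ j n {t p q s} → (+ 1 + j) * t ≡ (+ 1 + n) * (p * q) → (+ 1 + j) * s ≡ (+ 1 + n) * p →
            (+ 1 + j) * t ≡ (+ 1 + j) * (s * q)
  combine j n {t} {p} {q} {s} h₁ h₂ = lincomb₂ (+ 1) (- q) h₁ h₂
    (solve (j ∷ n ∷ t ∷ p ∷ q ∷ s ∷ []))

n∣j*top : ∀ j n → + n ∣ + j * top j n
n∣j*top zero n = divides (+ 0) refl
-- Divisibility by 0 demands that t_j(0) vanish for j > 0, which it does because binom(0, j) = 0.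
n∣j*top (suc i) zero = divides (+ 0)
  (trans (cong (+ suc i *_) (trans (top≡₁ (suc i) 0)
           (cong (_* binom (suc (suc i)) (suc (suc i))) (binom-vanish {0} {suc i} (s≤s z≤n)))))
         (*-zeroʳ (+ suc i)))
n∣j*top (suc i) (suc m) = divides (binom m i * binom (suc (suc m ℕ.+ suc i)) (suc (suc i)))
  (combine (+ i) (+ m) {top (suc i) (suc m)} {binom (suc m) (suc i)}
    {binom (suc (suc m ℕ.+ suc i)) (suc (suc i))} {binom m i} (top≡₁ (suc i) (suc m)) (absorb m i))
  where
  combine : ∀ i m {t p q s} → t ≡ p * q → (+ 1 + i) * p ≡ (+ 1 + m) * s →
            (+ 1 + i) * t ≡ s * q * (+ 1 + m)
  combine i m {t} {p} {q} {s} h₁ h₂ = lincomb₂ (+ 1 + i) q h₁ h₂ (solve (i ∷ m ∷ t ∷ p ∷ q ∷ s ∷ []))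

-- j binom(n+j+1, j) = (n+2) binom(n+j+1, j-1).
2+n∣j*top : ∀ j n → + 2 + + n ∣ + j * top j n
2+n∣j*top zero n = divides (+ 0) refl
2+n∣j*top (suc i) n = divides (binom (suc n) (suc (suc i)) * binom (suc (n ℕ.+ suc i)) i)
  (combine (+ i) (+ n) {top (suc i) n} {binom (suc n) (suc (suc i))}
    {binom (suc (n ℕ.+ suc i)) (suc i)} {binom (suc (n ℕ.+ suc i)) i}
    (top≡₂ (suc i) n) (lower-step (suc (n ℕ.+ suc i)) i))
  where
  combine : ∀ i n {t p q s} → t ≡ p * q → (+ 1 + i) * q ≡ (+ 1 + (n + (+ 1 + i)) - i) * s →
            (+ 1 + i) * t ≡ p * s * (+ 2 + n)
  combine i n {t} {p} {q} {s} h₁ h₂ = lincomb₂ (+ 1 + i) p h₁ h₂ (solve (i ∷ n ∷ t ∷ p ∷ q ∷ s ∷ []))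

modulus : ℕ → ℤ
modulus n = + n * (+ 1 + + n) * (+ 2 + + n)

-- The two divisors are coprime, since (n+1)² - n(n+2) = 1.
modulus∣ : ∀ n {x} → + 1 + + n ∣ x → + n * (+ 2 + + n) ∣ x → modulus n ∣ x
modulus∣ n {x} (divides p hp) (divides q hq) = divides ((+ 1 + + n) * q - p) (combine (+ n) p q x hp hq)
  where
  combine : ∀ n p q x → x ≡ p * (+ 1 + n) → x ≡ q * (n * (+ 2 + n)) →
            x ≡ ((+ 1 + n) * q - p) * (n * (+ 1 + n) * (+ 2 + n))
  combine n p q x hp hq = lincomb₂ (- (n * (+ 2 + n))) ((+ 1 + n) * (+ 1 + n)) hp hq
    (solve (n ∷ p ∷ q ∷ x ∷ []))

alt : ℕ → ℕ → ℤ
alt j n = top j n * (+ n * (+ 2 + + n) - + j)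

-- n(n+2) - j = (n+1)² - (j+1), and (j+1) t_j is a multiple of n+1 by `suc*top`.
1+n∣alt : ∀ j n → + 1 + + n ∣ alt j n
1+n∣alt j n = divides (top j n * (+ 1 + + n) - binom n j * binom (suc (n ℕ.+ j)) j)
  (combine (+ j) (+ n) (top j n) (binom n j * binom (suc (n ℕ.+ j)) j) (suc*top j n))
  where
  combine : ∀ j n t x → (+ 1 + j) * t ≡ (+ 1 + n) * x →
            t * (n * (+ 2 + n) - j) ≡ (t * (+ 1 + n) - x) * (+ 1 + n)
  combine j n t x h = lincomb₁ (- (+ 1)) h (solve (j ∷ n ∷ t ∷ x ∷ []))

-- For v = j t_j, write 2v = (n+2) v - n v; in each product the other factor is contained in v.
2*j*top : ∀ j n → + n * (+ 2 + + n) ∣ + 2 * (+ j * top j n)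
2*j*top j n with n∣j*top j n | 2+n∣j*top j n
... | divides p hp | divides q hq = divides (p - q) (combine (+ n) p q (+ j * top j n) hp hq)
  where
  combine : ∀ n p q v → v ≡ p * n → v ≡ q * (+ 2 + n) → + 2 * v ≡ (p - q) * (n * (+ 2 + n))
  combine n p q v hp hq = lincomb₂ (+ 2 + n) (- n) hp hq (solve (n ∷ p ∷ q ∷ v ∷ []))

alt≡ : ∀ j n → alt j n ≡ top j n * (+ n * (+ 2 + + n)) - + j * top j n
alt≡ j n = expand (+ j) (top j n) (+ n * (+ 2 + + n))
  where
  expand : ∀ j t d → t * (d - j) ≡ t * d - j * t
  expand j t d = solve (j ∷ t ∷ d ∷ [])

modulus∣2*alt : ∀ j n → modulus n ∣ + 2 * alt j n
modulus∣2*alt j n = modulus∣ n (∣n⇒∣m*n (+ 2) (1+n∣alt j n))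
  (subst (+ n * (+ 2 + + n) ∣_)
    (trans (double (+ j * top j n) (top j n * (+ n * (+ 2 + + n)))) (cong (+ 2 *_) (sym (alt≡ j n))))
    (∣m∣n⇒∣m-n (∣n⇒∣m*n (+ 2) (∣n⇒∣m*n (top j n) ∣-refl)) (2*j*top j n)))
  where
  double : ∀ x y → + 2 * y - + 2 * x ≡ + 2 * (y - x)
  double x y = solve (x ∷ y ∷ [])

-- For v = j t_j and n = 2r+1, write v = n v - r (2v). The first term is a multiple because n+2
-- divides v, the second by `2*j*top`.
j*top-odd : ∀ j r → let n = suc (r ℕ.+ r) in + n * (+ 2 + + n) ∣ + j * top j n
j*top-odd j r with 2*j*top j (suc (r ℕ.+ r)) | 2+n∣j*top j (suc (r ℕ.+ r))
... | divides p h₁ | divides q h₂ = divides (q - + r * p) (combine (+ r) (+ j * top j (suc (r ℕ.+ r))) p q h₁ h₂)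
  where
  combine : ∀ r v p q → let n = + 1 + (r + r) in + 2 * v ≡ p * (n * (+ 2 + n)) →
            v ≡ q * (+ 2 + n) → v ≡ (q - r * p) * (n * (+ 2 + n))
  combine r v p q h₁ h₂ = lincomb₂ (- r) (+ 1 + (r + r)) h₁ h₂ (solve (r ∷ v ∷ p ∷ q ∷ []))

modulus∣alt-odd : ∀ j r → let n = suc (r ℕ.+ r) in modulus n ∣ alt j n
modulus∣alt-odd j r = modulus∣ n (1+n∣alt j n)
  (subst (+ n * (+ 2 + + n) ∣_) (sym (alt≡ j n))
    (∣m∣n⇒∣m-n (∣n⇒∣m*n (top j n) ∣-refl) (j*top-odd j r)))
  where n = suc (r ℕ.+ r)

modulus∣alt-zero : ∀ n → modulus n ∣ alt 0 n
modulus∣alt-zero n = divides (+ 1) (combine (+ n) {basis 0 n} (basis-zero n))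
  where
  combine : ∀ n {b} → b ≡ + 1 → (+ 1 + n + + 0) * b * (n * (+ 2 + n) - + 0) ≡ + 1 * (n * (+ 1 + n) * (+ 2 + n))
  combine n refl = solve (n ∷ [])

-- In `top-suc`, (n-j)(n+j+2) = n(n+2) - j(j+2), so the terms j²(j+2) t_j cancel.
j*top-pair : ∀ j n → + j * (+ 2 + + j) * (+ j * top j n + + suc j * top (suc j) n) ≡
                     + j * top j n * (+ n * (+ 2 + + n))
j*top-pair j n = combine (+ j) (+ suc j) (+ n) (top j n) (top (suc j) n) refl (top-suc j n)
  where
  combine : ∀ j j′ n t u → j′ ≡ + 1 + j → (+ 1 + j) * (+ 2 + j) * u ≡ (n - j) * (+ 2 + n + j) * t →
            j * (+ 2 + j) * (j * t + j′ * u) ≡ j * t * (n * (+ 2 + n))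
  combine j _ n t u refl h = lincomb₁ j h (solve (j ∷ n ∷ t ∷ u ∷ []))

-- For odd l the number l(l + 2) = 4(i + 1)² - 1 is coprime to 2, so both factors can be cleared.
j*top-pair∣ : ∀ i n → let l = suc (i ℕ.+ i) in
              + n * (+ 2 + + n) ∣ + l * top l n + + suc l * top (suc l) n
j*top-pair∣ i n = conclude (2*j*top l n) (2*j*top (suc l) n)
  where
  l = suc (i ℕ.+ i)
  d = + n * (+ 2 + + n)
  v = + l * top l n
  w = + suc l * top (suc l) n
  e = (+ 1 + + i) * (+ 1 + + i)
  odd : ∀ i l → l ≡ + 1 + (i + i) → l * (+ 2 + l) ≡ + 4 * ((+ 1 + i) * (+ 1 + i)) - + 1
  odd i _ refl = solve (i ∷ [])
  combine : ∀ e v w p q d o → o ≡ + 4 * e - + 1 → + 2 * v ≡ p * d → + 2 * w ≡ q * d →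
            o * (v + w) ≡ v * d → v + w ≡ (+ 2 * e * (p + q) - v) * d
  combine e v w p q d _ refl h₁ h₂ h₃ = lincomb₃ (+ 2 * e) (+ 2 * e) (- (+ 1)) h₁ h₂ h₃
    (solve (e ∷ v ∷ w ∷ p ∷ q ∷ d ∷ []))
  conclude : d ∣ + 2 * v → d ∣ + 2 * w → d ∣ v + w
  conclude (divides p h₁) (divides q h₂) = divides (+ 2 * e * (p + q) - v)
    (combine e v w p q d (+ l * (+ 2 + + l)) (odd (+ i) (+ l) refl) h₁ h₂ (j*top-pair l n))

modulus∣alt-pair : ∀ i n → let l = suc (i ℕ.+ i) in modulus n ∣ alt l n + alt (suc l) n
modulus∣alt-pair i n = modulus∣ n (∣m∣n⇒∣m+n (1+n∣alt l n) (1+n∣alt (suc l) n))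
  (subst (+ n * (+ 2 + + n) ∣_)
    (trans (regroup (top l n) (top (suc l) n) (+ n * (+ 2 + + n)) (+ l * top l n) (+ suc l * top (suc l) n))
           (sym (cong₂ _+_ (alt≡ l n) (alt≡ (suc l) n))))
    (∣m∣n⇒∣m-n (∣n⇒∣m*n (top l n + top (suc l) n) ∣-refl) (j*top-pair∣ i n)))
  where
  l = suc (i ℕ.+ i)
  regroup : ∀ t u d v w → (t + u) * d - (v + w) ≡ (t * d - v) + (u * d - w)
  regroup t u d v w = solve (t ∷ u ∷ d ∷ v ∷ w ∷ [])

-- Finite sums and the two telescoping identities

prefix : ℕ → (ℕ → ℤ) → ℤ
prefix zero f = + 0
prefix (suc n) f = prefix n f + f n

prefix-cong : ∀ n {f g : ℕ → ℤ} → (∀ k → f k ≡ g k) → prefix n f ≡ prefix n g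
prefix-cong zero eq = refl
prefix-cong (suc n) eq = cong₂ _+_ (prefix-cong n eq) (eq n)

prefix-linear : ∀ n c {f g h : ℕ → ℤ} → (∀ k → h k ≡ c * f k + g k) →
                prefix n h ≡ c * prefix n f + prefix n g
prefix-linear zero c eq = sym (trans (+-identityʳ (c * + 0)) (*-zeroʳ c))
prefix-linear (suc n) c {f} {g} eq = combine c (prefix n f) (prefix n g) (f n) (g n) (prefix-linear n c eq) (eq n)
  where
  combine : ∀ c x y u v {s t} → s ≡ c * x + y → t ≡ c * u + v → s + t ≡ c * (x + u) + (y + v)
  combine c x y u v refl refl = solve (c ∷ x ∷ y ∷ u ∷ v ∷ [])

prefix-double : ∀ n (f : ℕ → ℤ) →
                prefix (n ℕ.+ n) f ≡ prefix n (λ r → f (r ℕ.+ r) + f (suc (r ℕ.+ r)))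
prefix-double zero f = refl
prefix-double (suc n) f rewrite ℕ.+-suc n n =
  trans (+-assoc (prefix (n ℕ.+ n) f) (f (n ℕ.+ n)) (f (suc (n ℕ.+ n))))
        (cong (_+ (f (n ℕ.+ n) + f (suc (n ℕ.+ n)))) (prefix-double n f))

sum : ℕ → (ℕ → ℤ) → ℤ
sum n f = prefix n (λ k → f (suc k))

mass : ℕ → ℤ
mass k = + k * (+ 1 + + k) * (+ 1 + + 2 * + k)

-- Induction on n: `basis-shift` rewrites the old boundary term through b_j(n+1), which leaves a
-- polynomial identity in j and n. The alternating sum below is treated alike.
sum-mass-basis : ∀ j n → (+ 2 + + j) * sum n (λ k → mass k * basis j k) ≡ modulus n * top j n
sum-mass-basis j zero = *-zeroʳ (+ 2 + + j)
sum-mass-basis j (suc n) = combine (+ j) (+ n)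
  {sum n (λ k → mass k * basis j k)} {basis j n} {basis j (suc n)} (sum-mass-basis j n) (basis-shift j n)
  where
  combine : ∀ j n {s b b′} → (+ 2 + j) * s ≡ n * (+ 1 + n) * (+ 2 + n) * ((+ 1 + n + j) * b) →
            (+ 1 + n + j) * b ≡ (+ 1 + n - j) * b′ → let n′ = + 1 + n in
            (+ 2 + j) * (s + n′ * (+ 1 + n′) * (+ 1 + + 2 * n′) * b′) ≡
            n′ * (+ 1 + n′) * (+ 2 + n′) * ((+ 1 + n′ + j) * b′)
  combine j n {s} {b} {b′} h₁ h₂ = lincomb₂ (+ 1) (n * (+ 1 + n) * (+ 2 + n)) h₁ h₂
    (solve (j ∷ n ∷ s ∷ b ∷ b′ ∷ []))

sum-sign-mass-basis : ∀ j n → sum n (λ k → sign k * mass k * basis j k) ≡ sign n * alt j n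
-- At n = 0 the factor n(n+2) - j vanishes for j = 0, and binom(j, 2j) vanishes for j > 0.
sum-sign-mass-basis zero zero = sym (trans (*-identityˡ (alt 0 0)) (*-zeroʳ (top 0 0)))
sum-sign-mass-basis (suc i) zero = sym (combine (+ i) (cat (suc i)) {binom (suc i) (2 ℕ.* suc i)}
  (binom-vanish {suc i} {2 ℕ.* suc i} (s≤s (ℕ.≤-trans (ℕ.≤-reflexive (sym (ℕ.+-identityʳ (suc i)))) (ℕ.m≤n+m _ i)))))
  where
  combine : ∀ i c {x} → x ≡ + 0 → + 1 * ((+ 1 + + 0 + (+ 1 + i)) * (x * c) * (+ 0 - (+ 1 + i))) ≡ + 0
  combine i c refl = solve (i ∷ c ∷ [])
sum-sign-mass-basis j (suc n) = combine (+ j) (+ n) (sign n)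
  {sum n (λ k → sign k * mass k * basis j k)} {basis j n} {basis j (suc n)} (sum-sign-mass-basis j n) (basis-shift j n)
  where
  combine : ∀ j n σ {s b b′} → s ≡ σ * ((+ 1 + n + j) * b * (n * (+ 2 + n) - j)) →
            (+ 1 + n + j) * b ≡ (+ 1 + n - j) * b′ → let n′ = + 1 + n in
            s + (- σ) * (n′ * (+ 1 + n′) * (+ 1 + + 2 * n′)) * b′ ≡
            (- σ) * ((+ 1 + n′ + j) * b′ * (n′ * (+ 2 + n′) - j))
  combine j n σ {s} {b} {b′} h₁ h₂ = lincomb₂ (+ 1) (σ * (n * (+ 2 + n) - j)) h₁ h₂
    (solve (j ∷ n ∷ σ ∷ s ∷ b ∷ b′ ∷ []))

-- The ℤ-span of the basis functions

-- The pointwise equations in `null` and `combine` make closure under pointwise equality,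
-- `respects`, a consequence, without function extensionality.
record IsSubgroup (P : (ℕ → ℤ) → Set) : Set where
  field
    null : ∀ {f} → (∀ k → f k ≡ + 0) → P f
    combine : ∀ {f g h} c → P f → P g → (∀ k → h k ≡ c * f k + g k) → P h

  respects : ∀ {f g} → (∀ k → g k ≡ f k) → P f → P g
  respects eq p = combine (+ 1) p (null {λ _ → + 0} (λ _ → refl)) λ k →
    trans (eq k) (sym (trans (+-identityʳ _) (*-identityˡ _)))

  scale : ∀ {f} c → P f → P (λ k → c * f k)
  scale c p = combine c p (null {λ _ → + 0} (λ _ → refl)) λ k → sym (+-identityʳ _)

  add : ∀ {f g} → P f → P g → P (λ k → f k + g k)
  add {f} {g} p q = combine (+ 1) p q λ k → cong (_+ g k) (sym (*-identityˡ (f k)))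

  prefix-closed : ∀ n {F : ℕ → ℕ → ℤ} → (∀ s → P (F s)) → P (λ k → prefix n (λ s → F s k))
  prefix-closed zero p = null λ _ → refl
  prefix-closed (suc n) p = add (prefix-closed n p) (p n)

-- Indices may repeat and come in any order, so sums need no normal form.
data Span : (ℕ → ℤ) → Set where
  empty : ∀ {f} → (∀ k → f k ≡ + 0) → Span f
  cons : ∀ {f g} c j → Span g → (∀ k → f k ≡ c * basis j k + g k) → Span f

-- The fixed multiplier `w` lets one induction serve both products with a given function and, with
-- `w` constantly 1, plain generation by the b_j.
span-elim : ∀ {P} → IsSubgroup P → (w : ℕ → ℤ) → (∀ j → P (λ k → w k * basis j k)) →
            ∀ {f} → Span f → P (λ k → w k * f k)
span-elim S w gen (empty eq) = IsSubgroup.null S λ k → trans (cong (w k *_) (eq k)) (*-zeroʳ (w k))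
span-elim S w gen (cons {f} {g} c j s eq) =
  IsSubgroup.combine S c (gen j) (span-elim S w gen s) λ k → distribute (w k) c (basis j k) (g k) (eq k)
  where
  distribute : ∀ w c x y {z} → z ≡ c * x + y → w * z ≡ c * (w * x) + w * y
  distribute w c x y refl = solve (w ∷ c ∷ x ∷ y ∷ [])

span-isSubgroup : IsSubgroup Span
span-isSubgroup = record { null = empty ; combine = linear }
  where
  linear : ∀ {f g h} c → Span f → Span g → (∀ k → h k ≡ c * f k + g k) → Span h
  linear {g = g} c (empty f≡0) (empty g≡0) eq = empty λ k →
    trans (eq k) (cong₂ _+_ (trans (cong (c *_) (f≡0 k)) (*-zeroʳ c)) (g≡0 k))
  linear {g = g} c (empty f≡0) (cons d j s eq′) eq = cons d j s λ k →
    trans (eq k) (trans (cong₂ _+_ (trans (cong (c *_) (f≡0 k)) (*-zeroʳ c)) (eq′ k)) (+-identityˡ _))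
  linear {g = g} c (cons {g = f′} d j s eq′) t eq = cons (c * d) j (linear c s t λ k → refl) λ k →
    regroup c d (basis j k) (f′ k) (g k) (eq′ k) (eq k)
    where
    regroup : ∀ c d b x y {f h} → f ≡ d * b + x → h ≡ c * f + y → h ≡ c * d * b + (c * x + y)
    regroup c d b x y refl refl = solve (c ∷ d ∷ b ∷ x ∷ y ∷ [])

open IsSubgroup

span-basis : ∀ j → Span (basis j)
span-basis j = cons (+ 1) j (empty {λ _ → + 0} λ _ → refl) λ k →
  sym (trans (+-identityʳ _) (*-identityˡ _))

pronic : ℕ → ℤ
pronic k = + k * (+ 1 + + k)

pronic*basis : ∀ j k → pronic k * basis j k ≡
  (+ 1 + + j) * (+ 2 + + j) * basis (suc j) k + + j * (+ 1 + + j) * basis j k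
pronic*basis j k = conclude (+ j) (pronic k) (basis j k) (basis (suc j) k) (basis-suc j k)
  where
  conclude : ∀ j N x y → (+ 1 + j) * (+ 2 + j) * y ≡ (N - j * (+ 1 + j)) * x →
             N * x ≡ (+ 1 + j) * (+ 2 + j) * y + j * (+ 1 + j) * x
  conclude j N x y h = lincomb₁ (- (+ 1)) h (solve (j ∷ N ∷ x ∷ y ∷ []))

span-pronic : ∀ {f} → Span f → Span (λ k → pronic k * f k)
span-pronic = span-elim span-isSubgroup pronic λ j →
  combine span-isSubgroup ((+ 1 + + j) * (+ 2 + + j)) (span-basis (suc j))
    (scale span-isSubgroup (+ j * (+ 1 + + j)) (span-basis j)) (pronic*basis j)

-- Linearization of products

-- (j + 1) times the coefficient of basis (s + j) in basis i * basis j.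
linkage : ℕ → ℕ → ℕ → ℤ
linkage i j s = binom i s * binom (suc (s ℕ.+ j)) (suc i) * binom (i ℕ.+ j) i

shifted : (ℕ → ℤ) → ℕ → ℤ
shifted f zero = + 0
shifted f (suc s) = f s

-- Compares coefficients of b_{s+j} when (k(k+1) - i(i+1)) b_i b_j is expanded with k(k+1) b_l =
-- (l+1)(l+2) b_{l+1} + l(l+1) b_l. The `shifted` term comes from l = s+j-1.
linkage-suc : ∀ i j s → (+ 1 + + i) * (+ 2 + + i) * linkage (suc i) j s ≡
  ((+ s + + j) * (+ 1 + + s + + j) - + i * (+ 1 + + i)) * linkage i j s
  + (+ s + + j) * (+ 1 + + s + + j) * shifted (linkage i j) s
linkage-suc i j zero = conclude (+ i) (+ j) (binom i 0) (binom (suc i) 0)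
    (binom (suc j) (suc i)) (binom (suc j) (suc (suc i))) (binom (i ℕ.+ j) i) (binom (suc (i ℕ.+ j)) (suc i))
    (binom-zero (suc i)) (binom-zero i) (lower-step (suc j) (suc i)) (absorb (i ℕ.+ j) i)
  where
  conclude : ∀ i j p p′ x y d e → p′ ≡ + 1 → p ≡ + 1 →
    (+ 1 + (+ 1 + i)) * y ≡ (+ 1 + j - (+ 1 + i)) * x → (+ 1 + i) * e ≡ (+ 1 + (i + j)) * d →
    (+ 1 + i) * (+ 2 + i) * (p′ * y * e) ≡
    ((+ 0 + j) * (+ 1 + + 0 + j) - i * (+ 1 + i)) * (p * x * d) + (+ 0 + j) * (+ 1 + + 0 + j) * + 0
  conclude i j p p′ x y d e refl refl h₁ h₂ =
    lincomb₂ ((+ 1 + i) * e) ((j - i) * x) h₁ h₂ (solve (i ∷ j ∷ x ∷ y ∷ d ∷ e ∷ []))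
linkage-suc i j (suc s) = conclude (+ i) (+ j) (+ s) (binom i s) (binom i (suc s)) (binom (suc i) (suc s))
    (binom (suc (suc (s ℕ.+ j))) (suc i)) (binom (suc (suc (s ℕ.+ j))) (suc (suc i)))
    (binom (suc (s ℕ.+ j)) (suc i)) (binom (i ℕ.+ j) i) (binom (suc (i ℕ.+ j)) (suc i))
    (pascal i s) (lower-step i s) (lower-step (suc (suc (s ℕ.+ j))) (suc i))
    (upper-step (suc (s ℕ.+ j)) (suc i)) (absorb (i ℕ.+ j) i)
  where
  conclude : ∀ i j s a a′ c b b₂ b₀ d e → c ≡ a + a′ → (+ 1 + s) * a′ ≡ (i - s) * a →
    (+ 1 + (+ 1 + i)) * b₂ ≡ (+ 1 + (+ 1 + (s + j)) - (+ 1 + i)) * b →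
    (+ 1 + (+ 1 + (s + j)) - (+ 1 + i)) * b ≡ (+ 1 + (+ 1 + (s + j))) * b₀ →
    (+ 1 + i) * e ≡ (+ 1 + (i + j)) * d →
    (+ 1 + i) * (+ 2 + i) * (c * b₂ * e) ≡
    ((+ 1 + s + j) * (+ 1 + (+ 1 + s) + j) - i * (+ 1 + i)) * (a′ * b * d)
    + (+ 1 + s + j) * (+ 1 + (+ 1 + s) + j) * (a * b₀ * d)
  conclude i j s a a′ c b b₂ b₀ d e refl h₁ h₂ h₃ h₄ =
    lincomb₂ ((+ 1 + i) * e * (a + a′)) ((+ 1 + s + j) * a * d) h₂ h₃
      (lincomb₂ (- ((+ 1 + s + j - i) * b * d)) ((a + a′) * (+ 1 + s + j - i) * b) h₁ h₄
        (solve (i ∷ j ∷ s ∷ a ∷ a′ ∷ b ∷ b₂ ∷ b₀ ∷ d ∷ e ∷ [])))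

-- Multiplication by k(k+1) sends part of the term at s to s+1. The second summand on the left is
-- what the last term, s = m-1, sends beyond the truncated sum.
linearization-step : ∀ i j k m →
  (+ 1 + + i) * (+ 2 + + i) * prefix m (λ s → linkage (suc i) j s * basis (s ℕ.+ j) k)
  + (+ m + + j) * (+ 1 + + m + + j) * (shifted (linkage i j) m * basis (m ℕ.+ j) k) ≡
  (pronic k - + i * (+ 1 + + i)) * prefix m (λ s → linkage i j s * basis (s ℕ.+ j) k)
linearization-step i j k zero = conclude (+ i) (+ j) (pronic k) (basis j k)
  where
  conclude : ∀ i j N b → (+ 1 + i) * (+ 2 + i) * + 0 + (+ 0 + j) * (+ 1 + + 0 + j) * (+ 0 * b) ≡
                         (N - i * (+ 1 + i)) * + 0
  conclude i j N b = solve (i ∷ j ∷ N ∷ b ∷ [])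
linearization-step i j k (suc m) = conclude (+ i) (+ j) (+ m) (pronic k)
    (prefix m λ s → linkage (suc i) j s * basis (s ℕ.+ j) k) (prefix m λ s → linkage i j s * basis (s ℕ.+ j) k)
    (linkage i j m) (linkage (suc i) j m) (shifted (linkage i j) m)
    (basis (m ℕ.+ j) k) (basis (suc (m ℕ.+ j)) k)
    (linearization-step i j k m) (basis-suc (m ℕ.+ j) k) (linkage-suc i j m)
  where
  conclude : ∀ i j m N u v l l′ p b b′ →
    (+ 1 + i) * (+ 2 + i) * u + (m + j) * (+ 1 + m + j) * (p * b) ≡ (N - i * (+ 1 + i)) * v →
    (+ 1 + (m + j)) * (+ 2 + (m + j)) * b′ ≡ (N - (m + j) * (+ 1 + (m + j))) * b →
    (+ 1 + i) * (+ 2 + i) * l′ ≡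
      ((m + j) * (+ 1 + m + j) - i * (+ 1 + i)) * l + (m + j) * (+ 1 + m + j) * p →
    (+ 1 + i) * (+ 2 + i) * (u + l′ * b) + (+ 1 + m + j) * (+ 1 + (+ 1 + m) + j) * (l * b′) ≡
    (N - i * (+ 1 + i)) * (v + l * b)
  conclude i j m N u v l l′ p b b′ h₁ h₂ h₃ = lincomb₃ (+ 1) l b h₁ h₂ h₃
    (solve (i ∷ j ∷ m ∷ N ∷ u ∷ v ∷ l ∷ l′ ∷ p ∷ b ∷ b′ ∷ []))

-- Induction on i: `basis-suc` turns b_{i+1} b_j into a multiple of (k(k+1) - i(i+1)) b_i b_j, which
-- `linearization-step` expands.
linearization : ∀ i j k → (+ 1 + + j) * (basis i k * basis j k) ≡
                          prefix (suc i) (λ s → linkage i j s * basis (s ℕ.+ j) k)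
linearization zero j k = conclude (+ j) (basis 0 k) (basis j k) (binom 0 0) (binom (suc j) 1) (binom j 0)
  (basis-zero k) (binom-zero 0) (binom-one (suc j)) (binom-zero j)
  where
  conclude : ∀ j b₀ b p q r → b₀ ≡ + 1 → p ≡ + 1 → q ≡ + 1 + j → r ≡ + 1 →
             (+ 1 + j) * (b₀ * b) ≡ + 0 + p * q * r * b
  conclude j _ b _ _ _ refl refl refl refl = solve (j ∷ b ∷ [])
linearization (suc i) j k = cancel-suc i (cancel-suc (suc i) (conclude (+ i) (+ suc i) (+ j) (+ suc (suc i)) (pronic k)
    (basis i k) (basis (suc i) k) (basis j k)
    (prefix (suc i) λ s → linkage i j s * basis (s ℕ.+ j) k)
    (prefix (suc (suc i)) λ s → linkage (suc i) j s * basis (s ℕ.+ j) k)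
    (binom i (suc i)) (binom (suc (suc i ℕ.+ j)) (suc i)) (binom (i ℕ.+ j) i)
    (basis (suc i ℕ.+ j) k) (basis (suc (suc i) ℕ.+ j) k) refl
    (basis-suc i k) (linearization i j k) (binom-vanish {i} {suc i} ℕ.≤-refl)
    (linearization-step i j k (suc (suc i)))))
  where
  -- The sum over s ≤ i extends to s ≤ i + 1, where the coefficient vanishes.
  conclude : ∀ i i′ j m N b b′ c v w x y z β γ → i′ ≡ + 1 + i →
    (+ 1 + i) * (+ 2 + i) * b′ ≡ (N - i * (+ 1 + i)) * b →
    (+ 1 + j) * (b * c) ≡ v → x ≡ + 0 →
    (+ 1 + i) * (+ 2 + i) * w + (m + j) * (+ 1 + m + j) * (x * y * z * γ) ≡
    (N - i * (+ 1 + i)) * (v + x * y * z * β) →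
    (+ 1 + i′) * ((+ 1 + i) * ((+ 1 + j) * (b′ * c))) ≡ (+ 1 + i′) * ((+ 1 + i) * w)
  conclude i _ j m N b b′ c _ w _ y z β γ refl h₁ refl refl h₂ = lincomb₂ ((+ 1 + j) * c) (- (+ 1)) h₁ h₂
    (solve (i ∷ j ∷ m ∷ N ∷ b ∷ b′ ∷ c ∷ w ∷ y ∷ z ∷ β ∷ γ ∷ []))

-- In `linkage-quotient` a factor s+j+1 appears; its part j+1 is wanted, and its part s is absorbed
-- here into the binomial.
s*binom : ∀ i s → ∃ λ a → + s * binom (suc i) s ≡ (+ 1 + + i) * a
s*binom i zero = + 0 , sym (*-zeroʳ (+ 1 + + i))
s*binom i (suc s) = binom i s , absorb i s

linkage-quotient : ∀ i j s → ∃ λ q → linkage (suc i) j s ≡ (+ 1 + + j) * q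
linkage-quotient i j s = A * D * B′ + proj₁ sA * D₀ * B′ - A * B * D₀ ,
  conclude (+ i) (+ j) (+ s) A B D (proj₁ sA) B′ D₀
    (lower-step (suc i ℕ.+ j) i) (absorb (s ℕ.+ j) (suc i)) (proj₂ sA)
  where
  A = binom (suc i) s
  B = binom (suc (s ℕ.+ j)) (suc (suc i))
  D = binom (suc i ℕ.+ j) (suc i)
  B′ = binom (s ℕ.+ j) (suc i)
  D₀ = binom (suc i ℕ.+ j) i
  sA = s*binom i s
  -- With I = i + 1, both I * linkage and (I + 1) * linkage are multiples of j + 1.
  conclude : ∀ i j s a b d a′ b′ d₀ → (+ 1 + i) * d ≡ (+ 1 + (i + j) - i) * d₀ →
    (+ 1 + (+ 1 + i)) * b ≡ (+ 1 + (s + j)) * b′ → s * a ≡ (+ 1 + i) * a′ →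
    a * b * d ≡ (+ 1 + j) * (a * d * b′ + a′ * d₀ * b′ - a * b * d₀)
  conclude i j s a b d a′ b′ d₀ h₁ h₂ h₃ = lincomb₃ (a′ * b′ - a * b) (a * d) (d * b′) h₁ h₂ h₃
    (solve (i ∷ j ∷ s ∷ a ∷ b ∷ d ∷ a′ ∷ b′ ∷ d₀ ∷ []))

prefix-zero : ∀ n → prefix n (λ _ → + 0) ≡ + 0
prefix-zero zero = refl
prefix-zero (suc n) = trans (+-identityʳ (prefix n (λ _ → + 0))) (prefix-zero n)

prefix-scale : ∀ n c (f : ℕ → ℤ) → prefix n (λ s → c * f s) ≡ c * prefix n f
prefix-scale n c f = trans (prefix-linear n c {f} {λ _ → + 0} (λ k → sym (+-identityʳ (c * f k))))
  (trans (cong (_+_ (c * prefix n f)) (prefix-zero n)) (+-identityʳ (c * prefix n f)))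

-- The quotients are a parameter: general products take those of `linkage-quotient`, squares the
-- closed form `squareCoeff`.
linearization-quotient : ∀ i j (q : ℕ → ℤ) → (∀ s → linkage i j s ≡ (+ 1 + + j) * q s) → ∀ k →
  basis i k * basis j k ≡ prefix (suc i) (λ s → q s * basis (s ℕ.+ j) k)
linearization-quotient i j q hq k = cancel-suc j (trans (linearization i j k)
  (trans (prefix-cong (suc i) λ s → trans (cong (_* basis (s ℕ.+ j) k) (hq s))
                                          (*-assoc (+ 1 + + j) (q s) (basis (s ℕ.+ j) k)))
         (prefix-scale (suc i) (+ 1 + + j) (λ s → q s * basis (s ℕ.+ j) k))))

span-basis*basis : ∀ i j → Span (λ k → basis i k * basis j k)
span-basis*basis zero j = respects span-isSubgroup
  (λ k → trans (cong (_* basis j k) (basis-zero k)) (*-identityˡ (basis j k))) (span-basis j)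
span-basis*basis (suc i) j = respects span-isSubgroup
  (linearization-quotient (suc i) j (λ s → proj₁ (linkage-quotient i j s)) (λ s → proj₂ (linkage-quotient i j s)))
  (prefix-closed span-isSubgroup (suc (suc i)) λ s →
    scale span-isSubgroup (proj₁ (linkage-quotient i j s)) (span-basis (s ℕ.+ j)))

span-* : ∀ {f g} → Span f → Span g → Span (λ k → f k * g k)
span-* {f} {g} sf sg = span-elim span-isSubgroup f
  (λ j → respects span-isSubgroup (λ k → *-comm (f k) (basis j k))
    (span-elim span-isSubgroup (basis j) (λ i → span-basis*basis j i) sf)) sg

-- Divisibility of weighted sums over the span

record DivisibleSum (n : ℕ) (c : ℤ) (w f : ℕ → ℤ) : Set where
  constructor divisibleSum
  field divisible : modulus n ∣ c * sum n (λ k → w k * f k)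

open DivisibleSum

divisibleSum-isSubgroup : ∀ n c w → IsSubgroup (DivisibleSum n c w)
divisibleSum-isSubgroup n c w = record
  { null = λ {f} eq → divisibleSum (subst (modulus n ∣_) (sym (vanish f eq)) (divides (+ 0) refl))
  ; combine = λ {f} {g} {h} d p q eq → divisibleSum (subst (modulus n ∣_) (sym (linear d f g h eq))
      (∣m∣n⇒∣m+n (∣n⇒∣m*n d (divisible p)) (divisible q)))
  }
  where
  total : (ℕ → ℤ) → ℤ
  total f = sum n (λ k → w k * f k)
  distribute : ∀ d w x y z → z ≡ d * x + y → w * z ≡ d * (w * x) + w * y
  distribute d w x y _ refl = solve (d ∷ w ∷ x ∷ y ∷ [])
  linear : ∀ d f g h → (∀ k → h k ≡ d * f k + g k) → c * total h ≡ d * (c * total f) + c * total g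
  linear d f g h eq = distribute d c (total f) (total g) (total h)
    (prefix-linear n d λ k → distribute d (w (suc k)) (f (suc k)) (g (suc k)) (h (suc k)) (eq (suc k)))
  vanish : ∀ f → (∀ k → f k ≡ + 0) → c * total f ≡ + 0
  vanish f eq = trans (cong (c *_) (trans (prefix-cong n λ k →
      trans (cong (w (suc k) *_) (eq (suc k))) (*-zeroʳ (w (suc k)))) (prefix-zero n))) (*-zeroʳ c)

divisibleSum-span : ∀ {n c w} → (∀ j → DivisibleSum n c w (basis j)) → ∀ {f} → Span f → DivisibleSum n c w f
divisibleSum-span {n} {c} {w} gen {f} s = respects S (λ k → sym (*-identityˡ (f k)))
  (span-elim S (λ _ → + 1) (λ j → respects S (λ k → *-identityˡ (basis j k)) (gen j)) s)
  where S = divisibleSum-isSubgroup n c w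

-- Cancelling j+2 in `sum-mass-basis` leaves the modulus times the quotient of c t_j by j+2.
basis-mass : ∀ {n} c → (∀ j → + 2 + + j ∣ c * top j n) → ∀ j → DivisibleSum n c mass (basis j)
basis-mass {n} c div j with div j
... | divides q eq = divisibleSum (divides q (cancel-suc (suc j)
  (conclude (+ j) c (sum n λ k → mass k * basis j k) (modulus n) (top j n) q (sum-mass-basis j n) eq)))
  where
  conclude : ∀ j c s m t q → (+ 2 + j) * s ≡ m * t → c * t ≡ q * (+ 2 + j) →
             (+ 2 + j) * (c * s) ≡ (+ 2 + j) * (q * m)
  conclude j c s m t q h₁ h₂ = lincomb₂ c m h₁ h₂ (solve (j ∷ c ∷ s ∷ m ∷ t ∷ q ∷ []))

mass-even : ∀ n {f} → Span f → DivisibleSum n (+ 2) mass f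
mass-even n = divisibleSum-span (basis-mass (+ 2) λ j → 2+j∣2*top j n)

mass-odd : ∀ r {f} → Span f → DivisibleSum (suc (r ℕ.+ r)) (+ 1) mass f
mass-odd r = divisibleSum-span (basis-mass (+ 1) λ j →
  subst (+ 2 + + j ∣_) (sym (*-identityˡ (top j (suc (r ℕ.+ r))))) (2+j∣top j r))

altMass : ℕ → ℤ
altMass k = sign k * mass k

basis-altMass : ∀ {n j} c → modulus n ∣ c * alt j n → DivisibleSum n c altMass (basis j)
basis-altMass {n} {j} c div = divisibleSum (subst (modulus n ∣_)
  (sym (trans (cong (c *_) (sum-sign-mass-basis j n)) (swap c (sign n) (alt j n))))
  (∣n⇒∣m*n (sign n) div))
  where
  swap : ∀ c σ x → c * (σ * x) ≡ σ * (c * x)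
  swap c σ x = solve (c ∷ σ ∷ x ∷ [])

altMass-even : ∀ n {f} → Span f → DivisibleSum n (+ 2) altMass f
altMass-even n = divisibleSum-span λ j → basis-altMass (+ 2) (modulus∣2*alt j n)

altMass-odd : ∀ r {f} → Span f → DivisibleSum (suc (r ℕ.+ r)) (+ 1) altMass f
altMass-odd r = divisibleSum-span λ j → basis-altMass (+ 1)
  (subst (modulus (suc (r ℕ.+ r)) ∣_) (sym (*-identityˡ (alt j (suc (r ℕ.+ r))))) (modulus∣alt-odd j r))


-- Squares modulo 2 in the alternating sum

-- For even j > 0 the recurrence reads (j+1) C_j = 2(2j-1) C_{j-1}, and j+1 is odd.
even-cat : ∀ r → ∃ λ e → cat (suc r ℕ.+ suc r) ≡ + 2 * e
even-cat r = (+ 1 + + 2 * + (r ℕ.+ suc r)) * cat (r ℕ.+ suc r) - (+ 1 + + r) * c ,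
  conclude (+ r) (+ (r ℕ.+ suc r)) c (cat (r ℕ.+ suc r)) refl (cat-suc (r ℕ.+ suc r))
  where
  c = cat (suc r ℕ.+ suc r)
  conclude : ∀ r j c d → j ≡ r + (+ 1 + r) → (+ 2 + j) * c ≡ + 2 * (+ 1 + + 2 * j) * d →
             c ≡ + 2 * ((+ 1 + + 2 * j) * d - (+ 1 + r) * c)
  conclude r _ c d refl h = lincomb₁ (+ 1) h (solve (r ∷ c ∷ d ∷ []))

-- This is `linkage j j s` divided by j+1, since binom(2j, j) = (j+1) C_j. The explicit factor C_j
-- makes the parity visible.
squareCoeff : ℕ → ℕ → ℤ
squareCoeff j s = binom j s * binom (suc (s ℕ.+ j)) (suc j) * cat j

basis-square : ∀ j k → basis j k * basis j k ≡ prefix (suc j) (λ s → squareCoeff j s * basis (s ℕ.+ j) k)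
basis-square j = linearization-quotient j j (squareCoeff j) λ s →
  conclude (+ j) (binom j s * binom (suc (s ℕ.+ j)) (suc j)) (cat j) (binom (j ℕ.+ j) j)
    (trans (suc*cat j) (cong (λ m → binom (j ℕ.+ m) j) (ℕ.+-identityʳ j)))
  where
  conclude : ∀ j x c d → (+ 1 + j) * c ≡ d → x * d ≡ (+ 1 + j) * (x * c)
  conclude j x c _ refl = solve (j ∷ x ∷ c ∷ [])

squareCoeff-pair : ∀ i r → let j = suc (i ℕ.+ i); s = r ℕ.+ r in
                   ∃ λ w → squareCoeff j (suc s) ≡ squareCoeff j s + + 2 * w
squareCoeff-pair i r = witness (+ i) (+ r) (squareCoeff j s) (squareCoeff j (suc s)) ,
  conclude (+ i) (+ r) (+ j) (+ s)
    (binom j s) (binom j (suc s)) (binom (suc (s ℕ.+ j)) (suc j)) (binom (suc (suc (s ℕ.+ j))) (suc j)) (cat j)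
    refl refl (lower-step j s) (upper-step (suc (s ℕ.+ j)) (suc j))
  where
  j = suc (i ℕ.+ i)
  s = r ℕ.+ r
  witness : ℤ → ℤ → ℤ → ℤ → ℤ
  witness i r z z′ = (+ 1 + i + i + + 2 * ((i - r) * (+ 1 + i + r))) * z - + 2 * (r * (+ 1 + r)) * z′
  -- The ratio of consecutive coefficients is (j - s)(j + s + 2)/(s + 1)², a quotient of odd numbers.
  conclude : ∀ i r j s a a′ b b′ c → j ≡ + 1 + (i + i) → s ≡ r + r →
    (+ 1 + s) * a′ ≡ (j - s) * a →
    (+ 1 + (+ 1 + (s + j)) - (+ 1 + j)) * b′ ≡ (+ 1 + (+ 1 + (s + j))) * b →
    a′ * b′ * c ≡ a * b * c +
      + 2 * ((+ 1 + i + i + + 2 * ((i - r) * (+ 1 + i + r))) * (a * b * c) - + 2 * (r * (+ 1 + r)) * (a′ * b′ * c))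
  conclude i r _ _ a a′ b b′ c refl refl h₁ h₂ =
    lincomb₂ ((+ 1 + (r + r)) * b′ * c) ((+ 1 + (i + i) - (r + r)) * a * c) h₁ h₂
      (solve (i ∷ r ∷ a ∷ a′ ∷ b ∷ b′ ∷ c ∷ []))

even-pronic : ∀ j → ∃ λ e → + j * (+ 1 + + j) ≡ + 2 * e
even-pronic j with parity j
... | inj₁ (r , refl) = + r * (+ 1 + + j) , conclude (+ r) (+ j) refl
  where
  conclude : ∀ r j → j ≡ r + r → j * (+ 1 + j) ≡ + 2 * (r * (+ 1 + j))
  conclude r _ refl = solve (r ∷ [])
... | inj₂ (r , refl) = + j * (+ 1 + + r) , conclude (+ r) (+ j) refl
  where
  conclude : ∀ r j → j ≡ + 1 + (r + r) → j * (+ 1 + j) ≡ + 2 * (j * (+ 1 + r))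
  conclude r _ refl = solve (r ∷ [])

module _ (n : ℕ) where
  -- Σ (-1)^k k(k+1)(2k+1) f k is divisible by n(n+1)(n+2), without any extra factor 2.
  Good : (ℕ → ℤ) → Set
  Good = DivisibleSum n (+ 1) altMass

  good : IsSubgroup Good
  good = divisibleSum-isSubgroup n (+ 1) altMass

  good-double : ∀ {f} → Span f → Good (λ k → + 2 * f k)
  good-double {f} s = divisibleSum (subst (modulus n ∣_)
    (sym (trans (*-identityˡ (sum n λ k → altMass k * (+ 2 * f k)))
      (trans (prefix-cong n λ k → swap (altMass (suc k)) (f (suc k)))
             (prefix-scale n (+ 2) λ k → altMass (suc k) * f (suc k)))))
    (divisible (altMass-even n s)))
    where
    swap : ∀ w x → w * (+ 2 * x) ≡ + 2 * (w * x)
    swap w x = solve (w ∷ x ∷ [])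

  good-zero : Good (basis 0)
  good-zero = basis-altMass (+ 1) (subst (modulus n ∣_) (sym (*-identityˡ (alt 0 n))) (modulus∣alt-zero n))

  good-pair : ∀ i → let l = suc (i ℕ.+ i) in Good (λ k → basis l k + basis (suc l) k)
  good-pair i = divisibleSum (subst (modulus n ∣_) (sym eq) (∣n⇒∣m*n (sign n) (modulus∣alt-pair i n)))
    where
    l = suc (i ℕ.+ i)
    split : ∀ w x y → w * (x + y) ≡ + 1 * (w * x) + w * y
    split w x y = solve (w ∷ x ∷ y ∷ [])
    collect : ∀ σ x y s t → s ≡ σ * x → t ≡ σ * y → + 1 * (+ 1 * s + t) ≡ σ * (x + y)
    collect σ x y _ _ refl refl = solve (σ ∷ x ∷ y ∷ [])
    eq : + 1 * sum n (λ k → altMass k * (basis l k + basis (suc l) k)) ≡ sign n * (alt l n + alt (suc l) n)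
    eq = trans (cong (+ 1 *_) (prefix-linear n (+ 1) λ k → split (altMass (suc k)) (basis l (suc k)) (basis (suc l) (suc k))))
      (collect (sign n) (alt l n) (alt (suc l) n) (sum n λ k → altMass k * basis l k)
        (sum n λ k → altMass k * basis (suc l) k) (sum-sign-mass-basis l n) (sum-sign-mass-basis (suc l) n))

  good-even : ∀ {f} c → (∃ λ e → c ≡ + 2 * e) → Span f → Good (λ k → c * f k)
  good-even {f} c (e , eq) s = respects good (λ k → rearrange c e (f k) eq) (scale good e (good-double s))
    where
    rearrange : ∀ c e x → c ≡ + 2 * e → c * x ≡ e * (+ 2 * x)
    rearrange _ e x refl = solve (e ∷ x ∷ [])

  good-adjacent : ∀ l z z′ i w → l ≡ suc (i ℕ.+ i) → z′ ≡ z + + 2 * w →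
                  Good (λ k → z * basis l k + z′ * basis (suc l) k)
  good-adjacent l z z′ i w refl eq = combine good z (good-pair i) (scale good w (good-double (span-basis (suc l))))
    λ k → rearrange z z′ w (basis l k) (basis (suc l) k) eq
    where
    rearrange : ∀ z z′ w x y → z′ ≡ z + + 2 * w → z * x + z′ * y ≡ z * (x + y) + w * (+ 2 * y)
    rearrange z _ w x y refl = solve (z ∷ w ∷ x ∷ y ∷ [])

  -- b_0² = b_0. For even j > 0 every coefficient of b_j² contains the even number C_j. For odd j
  -- the coefficients agree modulo 2 in adjacent pairs.
  good-basis-square : ∀ j → Good (λ k → basis j k * basis j k)
  good-basis-square j with parity j
  ... | inj₁ (zero , refl) = respects good
    (λ k → trans (cong (_* basis 0 k) (basis-zero k)) (*-identityˡ (basis 0 k))) (good-zero)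
  ... | inj₁ (suc r , refl) = respects good (basis-square j)
    (prefix-closed good (suc j) λ s → good-even (squareCoeff j s) (even s) (span-basis (s ℕ.+ j)))
    where
    rearrange : ∀ x c e → c ≡ + 2 * e → x * c ≡ + 2 * (x * e)
    rearrange x _ e refl = solve (x ∷ e ∷ [])
    even : ∀ s → ∃ λ e → squareCoeff j s ≡ + 2 * e
    even s = x * proj₁ (even-cat r) , rearrange x (cat j) (proj₁ (even-cat r)) (proj₂ (even-cat r))
      where x = binom j s * binom (suc (s ℕ.+ j)) (suc j)
  -- The j+1 = 2(i+1) terms are grouped as s = 2r and s = 2r+1. The lower index l = 2r+j of each
  -- pair is odd, as `good-pair` requires.
  ... | inj₂ (i , refl) = respects good
    (λ k → trans (basis-square j k) (trans (cong (λ m → prefix m (λ s → squareCoeff j s * basis (s ℕ.+ j) k))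
                                                  (cong suc (sym (ℕ.+-suc i i))))
                                           (prefix-double (suc i) (λ s → squareCoeff j s * basis (s ℕ.+ j) k))))
    (prefix-closed good (suc i) λ r → good-adjacent (r ℕ.+ r ℕ.+ j) (squareCoeff j (r ℕ.+ r)) (squareCoeff j (suc (r ℕ.+ r)))
      (r ℕ.+ i) (proj₁ (squareCoeff-pair i r))
      (trans (ℕ.+-suc (r ℕ.+ r) (i ℕ.+ i)) (cong suc (interchange r r i i)))
      (proj₂ (squareCoeff-pair i r)))

  -- Squaring is additive modulo 2: the cross term of (c b_j + g)² is twice an element of the span.
  good-square : ∀ {f} → Span f → Good (λ k → f k * f k)
  good-square {f} (empty eq) = null good λ k → trans (cong (f k *_) (eq k)) (*-zeroʳ (f k))
  good-square {f} (cons {g = g} c j s eq) = combine good (c * c) (good-basis-square j)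
    (add good (good-double (scale span-isSubgroup c (span-* (span-basis j) s))) (good-square s))
    λ k → expand c (basis j k) (g k) (f k) (eq k)
    where
    expand : ∀ c b x y → y ≡ c * b + x → y * y ≡ c * c * (b * b) + (+ 2 * (c * (b * x)) + x * x)
    expand c b x _ refl = solve (c ∷ b ∷ x ∷ [])

  -- Both coefficients in `pronic*basis` are multiples of a product of two consecutive integers,
  -- hence even.
  good-pronic : ∀ {f} → Span f → Good (λ k → pronic k * f k)
  good-pronic = span-elim good pronic λ j → respects good (pronic*basis j)
    (add good {λ k → (+ 1 + + j) * (+ 2 + + j) * basis (suc j) k} {λ k → + j * (+ 1 + + j) * basis j k}
      (good-even ((+ 1 + + j) * (+ 2 + + j)) (even-pronic (suc j)) (span-basis (suc j)))
              (good-even (+ j * (+ 1 + + j)) (even-pronic j) (span-basis j)))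

-- Convolution of coefficient sequences

conv : (ℕ → ℤ) → (ℕ → ℤ) → ℕ → ℤ
conv f g zero = f 0 * g 0
conv f g (suc i) = f 0 * g (suc i) + conv (λ j → f (suc j)) g i

conv-cong : ∀ {f f′ g g′} → (∀ i → f i ≡ f′ i) → (∀ i → g i ≡ g′ i) → ∀ i → conv f g i ≡ conv f′ g′ i
conv-cong p q zero = cong₂ _*_ (p 0) (q 0)
conv-cong p q (suc i) = cong₂ _+_ (cong₂ _*_ (p 0) (q (suc i))) (conv-cong (λ j → p (suc j)) q i)

conv-zero : ∀ g i → conv (λ _ → + 0) g i ≡ + 0
conv-zero g zero = refl
conv-zero g (suc i) = trans (+-identityˡ (conv (λ _ → + 0) g i)) (conv-zero g i)

conv-linear : ∀ c u v h i → conv (λ j → c * u j + v j) h i ≡ c * conv u h i + conv v h i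
conv-linear c u v h zero = expand c (u 0) (v 0) (h 0)
  where
  expand : ∀ c u v h → (c * u + v) * h ≡ c * (u * h) + v * h
  expand c u v h = solve (c ∷ u ∷ v ∷ h ∷ [])
conv-linear c u v h (suc i) = expand c (u 0) (v 0) (h (suc i))
    (conv (λ j → u (suc j)) h i) (conv (λ j → v (suc j)) h i)
    (conv (λ j → c * u (suc j) + v (suc j)) h i)
    (conv-linear c (λ j → u (suc j)) (λ j → v (suc j)) h i)
  where
  expand : ∀ c u v h x y z → z ≡ c * x + y → (c * u + v) * h + z ≡ c * (u * h + x) + (v * h + y)
  expand c u v h x y _ refl = solve (c ∷ u ∷ v ∷ h ∷ x ∷ y ∷ [])

conv-assoc : ∀ f g h i → conv (conv f g) h i ≡ conv f (conv g h) i
conv-assoc f g h zero = *-assoc (f 0) (g 0) (h 0)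
conv-assoc f g h (suc i) = regroup (f 0) (g 0) (h (suc i))
    (conv (λ j → g (suc j)) h i) (conv f′ (conv g h) i) (conv (λ j → conv f g (suc j)) h i)
    (trans (conv-linear (f 0) (λ j → g (suc j)) (conv f′ g) h i)
           (cong (_+_ (f 0 * conv (λ j → g (suc j)) h i)) (conv-assoc f′ g h i)))
  where
  f′ : ℕ → ℤ
  f′ j = f (suc j)
  regroup : ∀ f g h x y z → z ≡ f * x + y → f * g * h + z ≡ f * (g * h + x) + y
  regroup f g h x y _ refl = solve (f ∷ g ∷ h ∷ x ∷ y ∷ [])

-- Peels off the term at the opposite end from the definition, so that `good-conv-square` can remove
-- both outer terms.
conv-snoc : ∀ f g i → conv f g (suc i) ≡ f (suc i) * g 0 + conv f (λ j → g (suc j)) i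
conv-snoc f g zero = +-comm (f 0 * g 1) (f 1 * g 0)
conv-snoc f g (suc i) = regroup (f 0 * g (suc (suc i))) (f (suc (suc i)) * g 0)
    (conv (λ j → f (suc j)) (λ j → g (suc j)) i) (conv (λ j → f (suc j)) g (suc i))
    (conv-snoc (λ j → f (suc j)) g i)
  where
  regroup : ∀ x y z w → w ≡ y + z → x + w ≡ y + (x + z)
  regroup x y z _ refl = solve (x ∷ y ∷ z ∷ [])

-- Coefficients of polynomials

coeff-⊕ : ∀ p q i → coeff (p ⊕ q) i ≡ coeff p i + coeff q i
coeff-⊕ [] q i = sym (+-identityˡ (coeff q i))
coeff-⊕ (a ∷ p) [] i = sym (+-identityʳ (coeff (a ∷ p) i))
coeff-⊕ (a ∷ p) (b ∷ q) zero = refl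
coeff-⊕ (a ∷ p) (b ∷ q) (suc i) = coeff-⊕ p q i

coeff-· : ∀ c p i → coeff (c · p) i ≡ c * coeff p i
coeff-· c [] i = sym (*-zeroʳ c)
coeff-· c (a ∷ p) zero = refl
coeff-· c (a ∷ p) (suc i) = coeff-· c p i

coeff-⊛ : ∀ p q i → coeff (p ⊛ q) i ≡ conv (coeff p) (coeff q) i
coeff-⊛ [] q i = sym (conv-zero (coeff q) i)
coeff-⊛ (a ∷ p) q zero = trans (coeff-⊕ (a · q) (+ 0 ∷ p ⊛ q) 0)
  (trans (+-identityʳ (coeff (a · q) 0)) (coeff-· a q 0))
coeff-⊛ (a ∷ p) q (suc i) = trans (coeff-⊕ (a · q) (+ 0 ∷ p ⊛ q) (suc i))
  (cong₂ _+_ (coeff-· a q (suc i)) (coeff-⊛ p q i))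

coeff-one-⊛ : ∀ g i → conv (coeff one) g i ≡ g i
coeff-one-⊛ g zero = *-identityˡ (g 0)
coeff-one-⊛ g (suc i) = trans (cong₂ _+_ (*-identityˡ (g (suc i))) (conv-zero g i)) (+-identityʳ (g (suc i)))

-- For a = b this presents the coefficients of an even power as a convolution square.
coeff-^ₚ-+ : ∀ p a b i → coeff (p ^ₚ (a ℕ.+ b)) i ≡ conv (coeff (p ^ₚ a)) (coeff (p ^ₚ b)) i
coeff-^ₚ-+ p zero b i = sym (coeff-one-⊛ (coeff (p ^ₚ b)) i)
coeff-^ₚ-+ p (suc a) b i = begin
  coeff (p ⊛ p ^ₚ (a ℕ.+ b)) i                                   ≡⟨ coeff-⊛ p (p ^ₚ (a ℕ.+ b)) i ⟩
  conv (coeff p) (coeff (p ^ₚ (a ℕ.+ b))) i                      ≡⟨ conv-cong (λ _ → refl) (coeff-^ₚ-+ p a b) i ⟩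
  conv (coeff p) (conv (coeff (p ^ₚ a)) (coeff (p ^ₚ b))) i      ≡⟨ conv-assoc (coeff p) (coeff (p ^ₚ a)) (coeff (p ^ₚ b)) i ⟨
  conv (conv (coeff p) (coeff (p ^ₚ a))) (coeff (p ^ₚ b)) i      ≡⟨ conv-cong (λ j → sym (coeff-⊛ p (p ^ₚ a) j)) (λ _ → refl) i ⟩
  conv (coeff (p ⊛ p ^ₚ a)) (coeff (p ^ₚ b)) i                   ∎
  where open ≡-Reasoning

coeff-sumPoly : ∀ n g i → coeff (sumPoly n g) i ≡ sum n (λ k → coeff (g k) i)
coeff-sumPoly zero g i = refl
coeff-sumPoly (suc n) g i = trans (coeff-⊕ (sumPoly n g) (g (suc n)) i)
  (cong (λ x → x + coeff (g (suc n)) i) (coeff-sumPoly n g i))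

-- `coeff` is 0 past the end of the list, so the formula holds for all i once the entries vanish
-- there. The general `f` allows the induction to shift indices.
coeff-map-applyUpTo : ∀ (g : ℕ → ℤ) (f : ℕ → ℕ) n i → (i ≥ n → g (f i) ≡ + 0) →
                      coeff (map g (applyUpTo f n)) i ≡ g (f i)
coeff-map-applyUpTo g f zero i vanish = sym (vanish z≤n)
coeff-map-applyUpTo g f (suc n) zero vanish = refl
coeff-map-applyUpTo g f (suc n) (suc i) vanish =
  coeff-map-applyUpTo g (λ j → f (suc j)) n i (λ n≤i → vanish (s≤s n≤i))

-- The summands as elements of the span

span-conv : ∀ {F G : ℕ → ℕ → ℤ} → (∀ i → Span (λ k → F k i)) → (∀ i → Span (λ k → G k i)) →
            ∀ i → Span (λ k → conv (F k) (G k) i)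
span-conv sF sG zero = span-* (sF 0) (sG 0)
span-conv sF sG (suc i) = add span-isSubgroup (span-* (sF 0) (sG (suc i))) (span-conv (λ j → sF (suc j)) sG i)

-- The two outer terms F_0 F_i and F_i F_0 add up to a double. Stripping them leaves a shorter
-- convolution square, which ends in a single square or a double.
good-conv-square : ∀ n {F : ℕ → ℕ → ℤ} → (∀ i → Span (λ k → F k i)) →
                   ∀ i → Good n (λ k → conv (F k) (F k) i)
good-conv-square n s zero = good-square n (s 0)
good-conv-square n {F} s (suc zero) = respects (good n) (λ k → double (F k 0) (F k 1))
  (good-double n (span-* (s 0) (s 1)))
  where
  double : ∀ x y → x * y + y * x ≡ + 2 * (x * y)
  double x y = solve (x ∷ y ∷ [])
good-conv-square n {F} s (suc (suc i)) = respects (good n)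
  (λ k → outer (F k 0) (F k (suc (suc i))) (conv (λ j → F k (suc j)) (λ j → F k (suc j)) i)
               (conv (λ j → F k (suc j)) (F k) (suc i)) (conv-snoc (λ j → F k (suc j)) (F k) i))
  (add (good n) (good-double n (span-* (s 0) (s (suc (suc i))))) (good-conv-square n (λ j → s (suc j)) i))
  where
  outer : ∀ x y z w → w ≡ y * x + z → x * y + w ≡ + 2 * (x * y) + z
  outer x y z _ refl = solve (x ∷ y ∷ z ∷ [])

pos-^ : ∀ a n → + (a ℕ.^ n) ≡ (+ a) ^ n
pos-^ a zero = refl
pos-^ a (suc n) = trans (pos-* a (a ℕ.^ n)) (cong (+ a *_) (pos-^ a n))

*-^ : ∀ x y n → (x * y) ^ n ≡ x ^ n * y ^ n
*-^ x y zero = refl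
*-^ x y (suc n) = swap x y (x ^ n) (y ^ n) ((x * y) ^ n) (*-^ x y n)
  where
  swap : ∀ x y u v w → w ≡ u * v → x * y * w ≡ x * u * (y * v)
  swap x y u v _ refl = solve (x ∷ y ∷ u ∷ v ∷ [])

span-^ : ∀ {f} → Span f → ∀ h → Span (λ k → f k ^ h)
span-^ s zero = respects span-isSubgroup (λ k → sym (basis-zero k)) (span-basis 0)
span-^ s (suc h) = span-* s (span-^ s h)

schroder-entry : ∀ h k i →
  + (((k ℕ.+ i) C (2 ℕ.* i)) ℕ.^ h ℕ.* catalan i ℕ.^ h) ≡ basis i k ^ h
schroder-entry h k i = begin
  + (b ℕ.^ h ℕ.* catalan i ℕ.^ h)            ≡⟨ pos-* (b ℕ.^ h) (catalan i ℕ.^ h) ⟩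
  + (b ℕ.^ h) * + (catalan i ℕ.^ h)          ≡⟨ cong₂ _*_ (pos-^ b h) (pos-^ (catalan i) h) ⟩
  (+ b) ^ h * (+ catalan i) ^ h              ≡⟨ cong₂ (λ x y → x ^ h * y ^ h) (binom-def (k ℕ.+ i) (2 ℕ.* i)) (cat-def i) ⟨
  binom (k ℕ.+ i) (2 ℕ.* i) ^ h * cat i ^ h  ≡⟨ *-^ (binom (k ℕ.+ i) (2 ℕ.* i)) (cat i) h ⟨
  basis i k ^ h                              ∎
  where
  open ≡-Reasoning
  b = (k ℕ.+ i) C (2 ℕ.* i)

-- Past degree k the coefficient is 0, and so is b_i(k); its power agrees because the exponent is
-- positive.
coeff-schroder : ∀ h k i → coeff (schroder (suc h) k) i ≡ basis i k ^ suc h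
coeff-schroder h k i = trans
  (coeff-map-applyUpTo entry (λ j → j) (suc k) i λ k<i →
    trans (schroder-entry (suc h) k i) (cong (λ b → b * cat i * basis i k ^ h)
      (binom-vanish (ℕ.≤-trans (ℕ.+-monoˡ-≤ i k<i) (ℕ.+-monoʳ-≤ i (ℕ.m≤m+n i 0))))))
  (schroder-entry (suc h) k i)
  where
  entry : ℕ → ℤ
  entry j = + (((k ℕ.+ j) C (2 ℕ.* j)) ℕ.^ suc h ℕ.* catalan j ℕ.^ suc h)

span-schroder : ∀ h m i → Span (λ k → coeff (schroder (suc h) k ^ₚ m) i)
span-schroder h zero zero = respects span-isSubgroup (λ k → sym (basis-zero k)) (span-basis 0)
span-schroder h zero (suc i) = empty λ k → refl
span-schroder h (suc m) i = respects span-isSubgroup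
  (λ k → coeff-⊛ (schroder (suc h) k) (schroder (suc h) k ^ₚ m) i)
  (span-conv (λ j → respects span-isSubgroup (λ k → coeff-schroder h k j) (span-^ (span-basis j) (suc h)))
             (span-schroder h m) i)

-- One factor k(k+1) goes into `mass`, for the telescoping sums; the others act on the span.
weight≡ : ∀ a k → weight (suc a) k ≡ mass k * pronic k ^ a
weight≡ a k = begin
  + (k ℕ.^ suc a ℕ.* suc k ℕ.^ suc a ℕ.* suc (2 ℕ.* k))
    ≡⟨ pos-* (k ℕ.^ suc a ℕ.* suc k ℕ.^ suc a) (suc (2 ℕ.* k)) ⟩
  + (k ℕ.^ suc a ℕ.* suc k ℕ.^ suc a) * + suc (2 ℕ.* k)
    ≡⟨ cong₂ _*_ (trans (pos-* (k ℕ.^ suc a) (suc k ℕ.^ suc a)) (cong₂ _*_ (pos-^ k (suc a)) (pos-^ (suc k) (suc a))))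
                 (cong (_+_ (+ 1)) (pos-* 2 k)) ⟩
  (+ k) ^ suc a * (+ suc k) ^ suc a * (+ 1 + + 2 * + k)
    ≡⟨ cong (_* (+ 1 + + 2 * + k)) (*-^ (+ k) (+ suc k) (suc a)) ⟨
  pronic k * pronic k ^ a * (+ 1 + + 2 * + k)
    ≡⟨ swap (pronic k) (pronic k ^ a) (+ 1 + + 2 * + k) ⟩
  mass k * pronic k ^ a ∎
  where
  open ≡-Reasoning
  swap : ∀ x y z → x * y * z ≡ x * z * y
  swap x y z = solve (x ∷ y ∷ z ∷ [])

span-pronic^ : ∀ a {f} → Span f → Span (λ k → pronic k ^ a * f k)
span-pronic^ zero {f} s = respects span-isSubgroup (λ k → *-identityˡ (f k)) s
span-pronic^ (suc a) {f} s = respects span-isSubgroup (λ k → *-assoc (pronic k) (pronic k ^ a) (f k))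
  (span-pronic (span-pronic^ a s))

summand : ℕ → ℕ → ℕ → ℕ → ℕ → ℤ
summand h m a i k = pronic k ^ a * coeff (schroder (suc h) k ^ₚ m) i

span-summand : ∀ h m a i → Span (summand h m a i)
span-summand h m a i = span-pronic^ a (span-schroder h m i)

-- If a factor k(k+1) is left outside `mass`, it provides the evenness by `good-pronic`; otherwise
-- the summand is a convolution square.
good-summand : ∀ n h r a i → Good n (summand h (r ℕ.+ r) a i)
good-summand n h r (suc a) i = respects (good n)
  (λ k → *-assoc (pronic k) (pronic k ^ a) (coeff (schroder (suc h) k ^ₚ (r ℕ.+ r)) i))
  (good-pronic n (span-summand h (r ℕ.+ r) a i))
good-summand n h r zero i = respects (good n)
  (λ k → trans (*-identityˡ (coeff (schroder (suc h) k ^ₚ (r ℕ.+ r)) i)) (coeff-^ₚ-+ (schroder (suc h) k) r r i))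
  (good-conv-square n (span-schroder h r) i)

coeff-sum₁ : ∀ h m a n i → coeff (sum₁ (suc h) m (suc a) n) i ≡ sum n (λ k → mass k * summand h m a i k)
coeff-sum₁ h m a n i = trans (coeff-sumPoly n (λ k → weight (suc a) k · p k) i)
  (prefix-cong n λ k → trans (coeff-· (weight (suc a) (suc k)) (p (suc k)) i)
    (trans (cong (_* coeff (p (suc k)) i) (weight≡ a (suc k)))
           (*-assoc (mass (suc k)) (pronic (suc k) ^ a) (coeff (p (suc k)) i))))
  where
  p : ℕ → Poly
  p k = schroder (suc h) k ^ₚ m

coeff-sum₂ : ∀ h m a n i → coeff (sum₂ (suc h) m (suc a) n) i ≡ sum n (λ k → altMass k * summand h m a i k)
coeff-sum₂ h m a n i = trans (coeff-sumPoly n (λ k → (sign k * weight (suc a) k) · p k) i)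
  (prefix-cong n λ k → trans (coeff-· (sign (suc k) * weight (suc a) (suc k)) (p (suc k)) i)
    (trans (cong (λ w → sign (suc k) * w * coeff (p (suc k)) i) (weight≡ a (suc k)))
           (regroup (sign (suc k)) (mass (suc k)) (pronic (suc k) ^ a) (coeff (p (suc k)) i))))
  where
  p : ℕ → Poly
  p k = schroder (suc h) k ^ₚ m
  regroup : ∀ σ x y z → σ * (x * y) * z ≡ σ * x * (y * z)
  regroup σ x y z = solve (σ ∷ x ∷ y ∷ z ∷ [])

-- The gcd factors and the conclusion

modulus≡ : ∀ n → + (n ℕ.* suc n ℕ.* suc (suc n)) ≡ modulus n
modulus≡ n = trans (pos-* (n ℕ.* suc n) (suc (suc n))) (cong (_* + suc (suc n)) (pos-* n (suc n)))

divisibleSum-multiple : ∀ {n c w f} (d : ℤ) → DivisibleSum n c w f → c ∣ d → DivisibleSum n d w f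
divisibleSum-multiple {n} {c} {w} {f} _ p (divides q refl) = divisibleSum
  (subst (modulus n ∣_) (sym (*-assoc q c (sum n λ k → w k * f k))) (∣n⇒∣m*n q (divisible p)))

1∣ : ∀ d → + 1 ∣ d
1∣ d = divides d (sym (*-identityʳ d))

2∣double : ∀ r → 2 ℕ.∣ r ℕ.+ r
2∣double r = ℕ.divides r (trans (cong (r ℕ.+_) (sym (ℕ.+-identityʳ r))) (ℕ.*-comm 2 r))

mass-summand : ∀ n {f} → Span f → DivisibleSum n (+ gcd 2 n) mass f
mass-summand n s with parity n
... | inj₁ (r , refl) = divisibleSum-multiple (+ gcd 2 n) (mass-even n s)
  (∣ᵤ⇒∣ (gcd-greatest ℕ.∣-refl (2∣double r)))
... | inj₂ (r , refl) = divisibleSum-multiple (+ gcd 2 n) (mass-odd r s) (1∣ (+ gcd 2 n))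

altMass-summand : ∀ h m a n i → DivisibleSum n (+ gcd 2 (gcd (m ∸ 1) n)) altMass (summand h m a i)
altMass-summand h m a n i with parity m | parity n
... | inj₁ (r , refl) | _ = divisibleSum-multiple (+ gcd 2 (gcd (m ∸ 1) n)) (good-summand n h r a i) (1∣ _)
... | inj₂ _ | inj₂ (r , refl) =
  divisibleSum-multiple (+ gcd 2 (gcd (m ∸ 1) n)) (altMass-odd r (span-summand h m a i)) (1∣ _)
-- Only for odd m and even n is the factor 2 kept; then m-1 = 2q and n = 2r, so 2 divides the gcd.
... | inj₂ (q , refl) | inj₁ (r , refl) =
  divisibleSum-multiple (+ gcd 2 (gcd (m ∸ 1) n)) (altMass-even n (span-summand h m a i))
    (∣ᵤ⇒∣ (gcd-greatest ℕ.∣-refl (gcd-greatest (2∣double q) (2∣double r))))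

theorem3p1 : (h m n a : ℕ) → h ≥ 1 → m ≥ 1 → n ≥ 1 → a ≥ 1 →
    IntegralQuot (gcd 2 n) (n ℕ.* suc n ℕ.* suc (suc n)) (sum₁ h m a n)
    × IntegralQuot (gcd 2 (gcd (m ∸ 1) n)) (n ℕ.* suc n ℕ.* suc (suc n)) (sum₂ h m a n)
theorem3p1 (suc h) m n (suc a) _ _ _ _ =
  (λ i → integral (gcd 2 n) (coeff-sum₁ h m a n i) (mass-summand n (span-summand h m a i))) ,
  (λ i → integral (gcd 2 (gcd (m ∸ 1) n)) (coeff-sum₂ h m a n i) (altMass-summand h m a n i))
  where
  integral : ∀ c {x w f} → x ≡ sum n (λ k → w k * f k) → DivisibleSum n (+ c) w f →
             ℕ._∣_ ∣ + (n ℕ.* suc n ℕ.* suc (suc n)) ∣ ∣ + c * x ∣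
  integral c eq p = ∣⇒∣ᵤ (subst₂ _∣_ (sym (modulus≡ n)) (cong (+ c *_) (sym eq)) (divisible p))
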